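{- For integers $n\ge2$ and $0\le t\le n-2$, the number of $(102,012)$-avoiding inversion sequences $e$ of length $n$ with $\mathrm{rank}(e)=t$ is $(t+1)F_{2n-2t-3}$, where $F_k$ denotes the $k$-th Fibonacci number ($F_0=0$, $F_1=1$, $F_k=F_{k-1}+F_{k-2}$).
   Context: An inversion sequence of length $n$ is an integer sequence $e=(e_1,\dots,e_n)$ with $0\le e_j\le j-1$ for all $j$. It contains a pattern $w=w_1w_2w_3$ if there are indices $i_1<i_2<i_3$ such that $e_{i_1}e_{i_2}e_{i_3}$ is order-isomorphic to $w$ (same relations $<,=,>$ between corresponding pairs of entries); otherwise it avoids $w$. "$(w,w')$-avoiding" means avoiding both $w$ and $w'$. $\max(e)$ is the largest entry, and $\mathrm{fdes}(e)$ is the position $p$ of the first descent: $e_1\le\cdots\le e_p>e_{p+1}$, with the convention $e_{n+1}=-1$. For a $102$-avoiding $e$, $\mathrm{rank}(e):=\mathrm{fdes}(e)-\max(e)-1$. -}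

module Defs where

open import Data.Bool using (if_then_else_)
open import Data.Fin as Fin using (Fin; toℕ)
open import Data.Integer as ℤ using (ℤ; +_)
open import Data.List using (length)
open import Data.List.Membership.Propositional using (_∈_)
open import Data.List.Relation.Unary.Unique.Propositional using (Unique)
open import Data.Nat using (ℕ; suc; _+_; _≤_; _<_; _<ᵇ_; _⊔_)
open import Data.Product using (_×_; ∃-syntax)
open import Data.Vec using (Vec; []; _∷_; lookup; foldr′)
open import Function using (_⇔_)
open import Level using (Level)
open import Relation.Binary.PropositionalEquality using (_≡_)
open import Relation.Nullary using (¬_)
open import Relation.Unary using (Pred)

private
  variable
    a ℓ : Level
    k n : ℕ

-- Indices in Fin n start at 0, so e_j ≤ j − 1 reads lookup e i ≤ toℕ i
-- with j = suc (toℕ i).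
IsInversionSequence : Vec ℕ n → Set
IsInversionSequence {n} e = ∀ (i : Fin n) → lookup e i ≤ toℕ i

-- Agreement on > follows by exchanging i and j.
OrderIsomorphic : Vec ℕ k → Vec ℕ k → Set
OrderIsomorphic {k} u w = ∀ (i j : Fin k) →
  (lookup u i < lookup u j ⇔ lookup w i < lookup w j) ×
  (lookup u i ≡ lookup u j ⇔ lookup w i ≡ lookup w j)

Contains : Vec ℕ n → Vec ℕ 3 → Set
Contains {n} e w = ∃[ i₁ ] ∃[ i₂ ] ∃[ i₃ ]
  i₁ Fin.< i₂ × i₂ Fin.< i₃ ×
  OrderIsomorphic (lookup e i₁ ∷ lookup e i₂ ∷ lookup e i₃ ∷ []) w

Avoids : Vec ℕ n → Vec ℕ 3 → Set
Avoids e w = ¬ Contains e w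

-- The value 0 on the empty sequence is a dummy.
max : Vec ℕ n → ℕ
max = foldr′ _⊔_ 0

-- The 1-based position p with e_1 ≤ ⋯ ≤ e_p > e_{p+1}.  The singleton clause
-- encodes e_{n+1} = −1; the value on the empty sequence is a dummy.
fdes : Vec ℕ n → ℕ
fdes []          = 0
fdes (x ∷ [])    = 1
fdes (x ∷ y ∷ e) = if y <ᵇ x then 1 else suc (fdes (y ∷ e))

rank : Vec ℕ n → ℤ
rank e = + fdes e ℤ.- + max e ℤ.- + 1

F : ℕ → ℕ
F 0             = 0
F 1             = 1
F (suc (suc k)) = F (suc k) + F k

-- P holds of exactly m elements: they are listed, without repetition, by a
-- list of length m.
HasCardinality : {A : Set a} → Pred A ℓ → ℕ → Set (a Level.⊔ ℓ)
HasCardinality {A = A} P m = ∃[ xs ]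
  Unique xs × (∀ (x : A) → x ∈ xs ⇔ P x) × length xs ≡ m

{-# OPTIONS --safe #-}
-- Since e₁ = 0, avoiding 012 means that the nonzero entries weakly decrease, and
-- this already excludes 102.  Such a nonzero sequence is 0^k m^q v, where v is
-- empty or starts below m; it has first descent k + q and maximum m, so rank t
-- means k = m + d and q = t + 1 − d for one of the t + 1 values d ≤ t.  The number
-- of possible v depends only on m and on the length r of v, where
-- m + r = n − t − 1 =: N.  Let S(N) sum these numbers over m ≥ 1, and let D(N) be
-- the same sum without the condition on the first entry of v.  Then
-- S(N + 1) = D(N) + S(N) and D(N + 1) = S(N + 1) + D(N), so S(N) = F(2N − 1)
-- and D(N) = F(2N).
module Submission where

open import Defs
open import Data.Bool using (true; false)
open import Data.Empty using (⊥-elim)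
open import Data.Fin as Fin using (zero; suc; toℕ)
open import Data.Fin.Properties using (toℕ<n)
open import Data.Fin.Patterns using (0F; 1F; 2F)
import Data.Integer as ℤ
import Data.Integer.Properties as ℤ
import Data.Integer.Tactic.RingSolver as ℤ-Solver
import Data.List as List
open import Data.List.Membership.Propositional using (_∈_)
open import Data.List.Membership.Propositional.Properties using (∈-map⁺; ∈-map⁻; ++-∈⇔)
open import Data.List.Properties using (length-map; length-++)
open import Data.List.Relation.Unary.All using ([])
open import Data.List.Relation.Unary.AllPairs using ([]; _∷_)
open import Data.List.Relation.Unary.Any using (here)
import Data.List.Relation.Unary.Unique.Propositional.Properties as Unique
open import Data.Nat using (ℕ; zero; suc; _+_; _*_; _∸_; _≤_; _<_; z≤n; s≤s; _⊔_; _<ᵇ_; s≤s⁻¹)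
open import Data.Nat.Properties
open import Data.Nat.Tactic.RingSolver using (solve-∀)
open import Data.Product using (_×_; _,_; proj₁; proj₂; ∃-syntax)
open import Data.Sum as Sum using (_⊎_; inj₁; inj₂)
open import Data.Vec using (Vec; []; _∷_; lookup)
open import Data.Vec.Properties using (∷-injectiveʳ)
open import Function using (_∘_; _⇔_; mk⇔; Equivalence)
open import Level using (Level)
open import Relation.Binary.PropositionalEquality
open import Relation.Nullary using (¬_; ofʸ; ofⁿ)
open import Relation.Unary using (Pred)

open Equivalence using (to; from)

private
  variable
    a ℓ : Level
    A : Set a
    P Q : Pred A ℓ
    i j k m n p q t x y z : ℕ

-- Sums over antidiagonals and their Fibonacci values

-- The sum runs over i + r = n − 1.
antidiagonalSum : (ℕ → ℕ → ℕ) → ℕ → ℕ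
antidiagonalSum f zero    = 0
antidiagonalSum f (suc n) = f 0 n + antidiagonalSum (f ∘ suc) n

antidiagonalSum-const : ∀ c n → antidiagonalSum (λ _ _ → c) n ≡ n * c
antidiagonalSum-const c zero    = refl
antidiagonalSum-const c (suc n) = cong (c +_) (antidiagonalSum-const c n)

antidiagonalSum-+ : ∀ f g n →
  antidiagonalSum (λ i r → f i r + g i r) n ≡ antidiagonalSum f n + antidiagonalSum g n
antidiagonalSum-+ f g zero    = refl
antidiagonalSum-+ f g (suc n) = trans
  (cong (f 0 n + g 0 n +_) (antidiagonalSum-+ (f ∘ suc) (g ∘ suc) n))
  (interchange (f 0 n) (g 0 n) (antidiagonalSum (f ∘ suc) n) (antidiagonalSum (g ∘ suc) n))
  where
  interchange : ∀ b c d e → b + c + (d + e) ≡ b + d + (c + e)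
  interchange = solve-∀

-- The definition splits off the summand with `i = 0`. Splitting off the one with `r = 0` leaves
-- only summands to which the `suc r` clauses of the counts below apply.
antidiagonalSum-last : ∀ f n →
  antidiagonalSum f (suc n) ≡ antidiagonalSum (λ i r → f i (suc r)) n + f n 0
antidiagonalSum-last f zero    = +-identityʳ (f 0 0)
antidiagonalSum-last f (suc n) = trans
  (cong (f 0 (suc n) +_) (antidiagonalSum-last (f ∘ suc) n))
  (sym (+-assoc (f 0 (suc n)) _ (f (suc n) 0)))

-- With i + 1 in place of m: sequences of length r whose nonzero entries weakly
-- decrease from at most i + 1 (antitoneCount), and those among them that are empty
-- or start below i + 1 (afterRunCount).
antitoneCount : ℕ → ℕ → ℕ
antitoneCount i zero    = 1
antitoneCount i (suc r) =
  (antitoneCount i r + antidiagonalSum (λ j _ → antitoneCount j r) i) + antitoneCount i r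

afterRunCount : ℕ → ℕ → ℕ
afterRunCount i zero    = 1
afterRunCount i (suc r) = antitoneCount i r + antidiagonalSum (λ j _ → antitoneCount j r) i

-- Beyond the term `r = 0`, the `suc r` clause of `afterRunCount` splits the sum in two. The half
-- made of `lower` turns back into a sum of `afterRunCount` once `i` is shifted by one.
afterRunSum-step : ∀ n →
  antidiagonalSum afterRunCount (2 + n) ≡
  antidiagonalSum antitoneCount (1 + n) + antidiagonalSum afterRunCount (1 + n)
afterRunSum-step n = begin
  antidiagonalSum afterRunCount (2 + n)
    ≡⟨ antidiagonalSum-last afterRunCount (1 + n) ⟩
  antidiagonalSum (λ i r → antitoneCount i r + lower i r) (1 + n) + 1
    ≡⟨ cong (_+ 1) (antidiagonalSum-+ antitoneCount lower (1 + n)) ⟩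
  -- `lower 0 n` is an empty sum and computes to 0, so the sum of `lower` may start at `i = 1`.
  antidiagonalSum antitoneCount (1 + n) + antidiagonalSum (lower ∘ suc) n + 1
    ≡⟨ +-assoc (antidiagonalSum antitoneCount (1 + n)) _ 1 ⟩
  antidiagonalSum antitoneCount (1 + n) + (antidiagonalSum (lower ∘ suc) n + 1)
    ≡⟨ cong (λ s → antidiagonalSum antitoneCount (1 + n) + (s + 1)) (shift n) ⟩
  antidiagonalSum antitoneCount (1 + n) +
    (antidiagonalSum (λ i r → afterRunCount i (suc r)) n + 1)
    ≡⟨ cong (antidiagonalSum antitoneCount (1 + n) +_) (antidiagonalSum-last afterRunCount n) ⟨
  antidiagonalSum antitoneCount (1 + n) + antidiagonalSum afterRunCount (1 + n) ∎
  where
  open ≡-Reasoning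

  lower : ℕ → ℕ → ℕ
  lower i r = antidiagonalSum (λ j _ → antitoneCount j r) i

  cong-sum : ∀ {f g : ℕ → ℕ → ℕ} → (∀ i r → f i r ≡ g i r) →
    ∀ n → antidiagonalSum f n ≡ antidiagonalSum g n
  cong-sum f≗g zero    = refl
  cong-sum f≗g (suc n) = cong₂ _+_ (f≗g 0 n) (cong-sum (f≗g ∘ suc) n)

  -- Raising the bound by one adds the summand `antitoneCount i r` to `lower i r`; this is also the
  -- number of continuations after a leading 0.
  shift : ∀ n → antidiagonalSum (lower ∘ suc) n ≡
                antidiagonalSum (λ i r → afterRunCount i (suc r)) n
  shift = cong-sum λ i r → trans
    (antidiagonalSum-last (λ j _ → antitoneCount j r) i)
    (+-comm _ (antitoneCount i r))

-- The bracket in the `suc r` clause of `antitoneCount` is `afterRunCount i (suc r)` by computation,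
-- and the 1 from `r = 0` completes the sum of `afterRunCount`.
antitoneSum-step : ∀ n →
  antidiagonalSum antitoneCount (1 + n) ≡
  antidiagonalSum afterRunCount (1 + n) + antidiagonalSum antitoneCount n
antitoneSum-step n = begin
  antidiagonalSum antitoneCount (1 + n)
    ≡⟨ antidiagonalSum-last antitoneCount n ⟩
  antidiagonalSum (λ i r → w⁺ i r + antitoneCount i r) n + 1
    ≡⟨ cong (_+ 1) (antidiagonalSum-+ w⁺ antitoneCount n) ⟩
  antidiagonalSum w⁺ n + antidiagonalSum antitoneCount n + 1
    ≡⟨ swap (antidiagonalSum w⁺ n) (antidiagonalSum antitoneCount n) ⟩
  antidiagonalSum w⁺ n + 1 + antidiagonalSum antitoneCount n
    ≡⟨ cong (_+ antidiagonalSum antitoneCount n) (antidiagonalSum-last afterRunCount n) ⟨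
  antidiagonalSum afterRunCount (1 + n) + antidiagonalSum antitoneCount n ∎
  where
  open ≡-Reasoning

  w⁺ : ℕ → ℕ → ℕ
  w⁺ i r = afterRunCount i (suc r)

  swap : ∀ b c → b + c + 1 ≡ b + 1 + c
  swap = solve-∀

-- With `n * 2` instead of `2 * n`, the index at `suc n` computes to two more than at `n`, so the
-- recursion of `F` unfolds by itself.
fibonacciSums : ∀ n →
  antidiagonalSum afterRunCount (suc n) ≡ F (1 + n * 2) ×
  antidiagonalSum antitoneCount (suc n) ≡ F (2 + n * 2)
fibonacciSums zero    = refl , refl
fibonacciSums (suc n) = odd , trans (antitoneSum-step (suc n)) (cong₂ _+_ odd even′)
  where
  even′ = proj₂ (fibonacciSums n)
  odd   = trans (afterRunSum-step n) (cong₂ _+_ even′ (proj₁ (fibonacciSums n)))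

-- Cardinality

card-⇔ : (∀ x → P x ⇔ Q x) → HasCardinality P m → HasCardinality Q m
card-⇔ P⇔Q (xs , unique , ∈⇔P , len) = xs , unique ,
  (λ x → mk⇔ (to (P⇔Q x) ∘ to (∈⇔P x)) (from (∈⇔P x) ∘ from (P⇔Q x))) , len

card-∅ : (∀ x → ¬ P x) → HasCardinality P 0
card-∅ ¬P = List.[] , [] , (λ x → mk⇔ (λ ()) (⊥-elim ∘ ¬P x)) , refl

card-⊎ : (∀ {x} → P x → ¬ Q x) → HasCardinality P m → HasCardinality Q n →
  HasCardinality (λ x → P x ⊎ Q x) (m + n)
card-⊎ disjoint (xs , xs! , ∈⇔P , refl) (ys , ys! , ∈⇔Q , refl) =
  xs List.++ ys ,
  Unique.++⁺ xs! ys! (λ (x∈xs , x∈ys) → disjoint (to (∈⇔P _) x∈xs) (to (∈⇔Q _) x∈ys)) ,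
  (λ x → mk⇔ (Sum.map (to (∈⇔P x)) (to (∈⇔Q x)) ∘ to ++-∈⇔)
             (from ++-∈⇔ ∘ Sum.map (from (∈⇔P x)) (from (∈⇔Q x)))) ,
  length-++ xs

-- The complement `r` of `i` is handed to `c` because it will be the length left for a tail; a `c`
-- that ignores it gives an ordinary sum over `i < n`.
card-⋃ : ∀ n (c : ℕ → ℕ → ℕ) {P : ℕ → Pred A ℓ} →
  (∀ {i j x} → P i x → P j x → i ≡ j) →
  (∀ i r → suc (i + r) ≡ n → HasCardinality (P i) (c i r)) →
  HasCardinality (λ x → ∃[ i ] i < n × P i x) (antidiagonalSum c n)
card-⋃ zero    c disjoint card = card-∅ λ { _ (_ , () , _) }
card-⋃ (suc n) c disjoint card = card-⇔
  (λ x → mk⇔ (λ { (inj₁ p) → 0 , s≤s z≤n , p ; (inj₂ (i , i<n , p)) → suc i , s≤s i<n , p })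
             (λ { (zero , _ , p) → inj₁ p ; (suc i , s≤s i<n , p) → inj₂ (i , i<n , p) }))
  (card-⊎ (λ { p (_ , _ , q) → 0≢1+n (disjoint p q) })
    (card 0 n refl)
    (card-⋃ n (c ∘ suc) (λ p q → suc-injective (disjoint p q))
      (λ i r eq → card (suc i) r (cong suc eq))))

card-[] : {P : Pred (Vec ℕ 0) ℓ} → P [] → HasCardinality P 1
card-[] p[] = [] List.∷ List.[] , ([] ∷ []) ,
  (λ { [] → mk⇔ (λ _ → p[]) (λ _ → here refl) }) , refl

infixr 5 _◂_

_◂_ : ℕ → Pred (Vec ℕ n) ℓ → Pred (Vec ℕ (suc n)) ℓ
(x ◂ P) (y ∷ v) = y ≡ x × P v

card-◂ : ∀ x {P : Pred (Vec ℕ n) ℓ} → HasCardinality P m → HasCardinality (x ◂ P) m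
card-◂ x {P} (xs , xs! , ∈⇔P , refl) =
  List.map (x ∷_) xs , Unique.map⁺ ∷-injectiveʳ xs! , mem , length-map (x ∷_) xs
  where
  mem : ∀ v → v ∈ List.map (x ∷_) xs ⇔ (x ◂ P) v
  mem (y ∷ v) = mk⇔
    (λ v∈ → uncons (∈-map⁻ (x ∷_) v∈))
    (λ { (refl , Pv) → ∈-map⁺ (x ∷_) (from (∈⇔P v) Pv) })
    where
    uncons : (∃[ u ] u ∈ xs × y ∷ v ≡ x ∷ u) → y ≡ x × P v
    uncons (_ , u∈xs , refl) = refl , to (∈⇔P v) u∈xs

-- The shape of avoiding sequences

-- `Q` covers all lengths, so runs can be nested without writing the length of the vector as a sum.
-- Whether a run is maximal is left to `Q`.
data Run (x : ℕ) (Q : ∀ {n} → Vec ℕ n → Set) : ℕ → Vec ℕ n → Set where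
  stop : {v : Vec ℕ n} → Q v → Run x Q 0 v
  more : {v : Vec ℕ n} → Run x Q k v → Run x Q (suc k) (x ∷ v)

card-Run : ∀ k {Q : ∀ {n} → Vec ℕ n → Set} →
  HasCardinality (Q {n}) m → HasCardinality {A = Vec ℕ (k + n)} (Run x Q k) m
card-Run zero    card = card-⇔ (λ _ → mk⇔ stop λ { (stop q) → q }) card
card-Run (suc k) card = card-⇔
  (λ { (_ ∷ _) → mk⇔ (λ { (refl , run) → more run }) λ { (more run) → refl , run } })
  (card-◂ _ (card-Run k card))

Run-length : {Q : ∀ {n} → Vec ℕ n → Set} → (∀ {n} {v : Vec ℕ n} → Q v → m ≤ n) →
  {e : Vec ℕ n} → Run x Q k e → k + m ≤ n
Run-length Q⇒≤ (stop q)   = Q⇒≤ q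
Run-length Q⇒≤ (more run) = s≤s (Run-length Q⇒≤ run)

data NonzeroAntitone (m : ℕ) : Vec ℕ n → Set where
  []  : NonzeroAntitone m []
  0∷_ : {v : Vec ℕ n} → NonzeroAntitone m v → NonzeroAntitone m (0 ∷ v)
  _∷_ : {v : Vec ℕ n} → suc j ≤ m → NonzeroAntitone (suc j) v → NonzeroAntitone m (suc j ∷ v)

-- What may follow a maximal run of the largest entry m.
data AfterRun (m : ℕ) : Vec ℕ n → Set where
  end     : AfterRun m []
  descent : {v : Vec ℕ n} → x < m → NonzeroAntitone m (x ∷ v) → AfterRun m (x ∷ v)

-- A nonempty sequence either starts with the bound itself or is of the form `AfterRun`. In the
-- latter a leading 0 keeps the bound, and a leading `suc j` with `j < i` becomes the new bound.
card-NonzeroAntitone : ∀ i r → HasCardinality (NonzeroAntitone (suc i) {r}) (antitoneCount i r)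
card-AfterRun : ∀ i r → HasCardinality (AfterRun (suc i) {r}) (afterRunCount i r)

card-NonzeroAntitone i zero    = card-[] []
card-NonzeroAntitone i (suc r) = card-⇔
  (λ { (x ∷ v) → mk⇔ fwd bwd })
  (card-⊎ disjoint (card-AfterRun i (suc r)) (card-◂ (suc i) (card-NonzeroAntitone i r)))
  where
  disjoint : {e : Vec ℕ (suc r)} →
    AfterRun (suc i) e → ¬ (suc i ◂ NonzeroAntitone (suc i)) e
  disjoint (descent x<m _) (refl , _) = <-irrefl refl x<m

  fwd : {v : Vec ℕ r} →
    AfterRun (suc i) (x ∷ v) ⊎ (suc i ◂ NonzeroAntitone (suc i)) (x ∷ v) →
    NonzeroAntitone (suc i) (x ∷ v)
  fwd (inj₁ (descent _ anti))  = anti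
  fwd (inj₂ (refl , anti)) = ≤-refl ∷ anti

  bwd : {v : Vec ℕ r} → NonzeroAntitone (suc i) (x ∷ v) →
    AfterRun (suc i) (x ∷ v) ⊎ (suc i ◂ NonzeroAntitone (suc i)) (x ∷ v)
  bwd (0∷ anti) = inj₁ (descent (s≤s z≤n) (0∷ anti))
  bwd (j≤i ∷ anti) with m≤n⇒m<n∨m≡n j≤i
  ... | inj₁ j<i  = inj₁ (descent j<i (j≤i ∷ anti))
  ... | inj₂ refl = inj₂ (refl , anti)

card-AfterRun i zero    = card-[] end
card-AfterRun i (suc r) = card-⇔
  (λ { (x ∷ v) → mk⇔ fwd bwd })
  (card-⊎ (λ { {_ ∷ _} (refl , _) (_ , _ , () , _) })
    (card-◂ 0 (card-NonzeroAntitone i r))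
    (card-⋃ i (λ j _ → antitoneCount j r) {P = λ j → suc j ◂ NonzeroAntitone (suc j)}
      (λ { {x = _ ∷ _} (refl , _) (refl , _) → refl })
      (λ j _ _ → card-◂ (suc j) (card-NonzeroAntitone j r))))
  where
  fwd : {v : Vec ℕ r} →
    (0 ◂ NonzeroAntitone (suc i)) (x ∷ v) ⊎
    (∃[ j ] j < i × (suc j ◂ NonzeroAntitone (suc j)) (x ∷ v)) →
    AfterRun (suc i) (x ∷ v)
  fwd (inj₁ (refl , anti))           = descent (s≤s z≤n) (0∷ anti)
  fwd (inj₂ (j , j<i , refl , anti)) = descent (s≤s j<i) (m<n⇒m<1+n j<i ∷ anti)

  bwd : {v : Vec ℕ r} → AfterRun (suc i) (x ∷ v) →
    (0 ◂ NonzeroAntitone (suc i)) (x ∷ v) ⊎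
    (∃[ j ] j < i × (suc j ◂ NonzeroAntitone (suc j)) (x ∷ v))
  bwd (descent _ (0∷ anti))           = inj₁ (refl , anti)
  bwd (descent (s≤s j<i) (_ ∷ anti)) = inj₂ (_ , j<i , refl , anti)

-- Pattern avoidance as absence of ascents above zero

NonzeroAntitone⇒≤ : {v : Vec ℕ n} → NonzeroAntitone m v → ∀ i → lookup v i ≤ m
NonzeroAntitone⇒≤ (0∷ _)       zero    = z≤n
NonzeroAntitone⇒≤ (j≤m ∷ _)    zero    = j≤m
NonzeroAntitone⇒≤ (0∷ anti)    (suc i) = NonzeroAntitone⇒≤ anti i
NonzeroAntitone⇒≤ (j≤m ∷ anti) (suc i) = ≤-trans (NonzeroAntitone⇒≤ anti i) j≤m

NonzeroAntitone⇒max≤ : {v : Vec ℕ n} → NonzeroAntitone m v → max v ≤ m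
NonzeroAntitone⇒max≤ []           = z≤n
NonzeroAntitone⇒max≤ (0∷ anti)    = NonzeroAntitone⇒max≤ anti
NonzeroAntitone⇒max≤ (j≤m ∷ anti) = ⊔-lub j≤m (≤-trans (NonzeroAntitone⇒max≤ anti) j≤m)

NoAscentAboveZero : Vec ℕ n → Set
NoAscentAboveZero v = ∀ i j → i Fin.< j → 0 < lookup v i → lookup v j ≤ lookup v i

NonzeroAntitone⇒NoAscentAboveZero : {v : Vec ℕ n} →
  NonzeroAntitone m v → NoAscentAboveZero v
NonzeroAntitone⇒NoAscentAboveZero (_ ∷ anti) zero    (suc j) _ _ = NonzeroAntitone⇒≤ anti j
NonzeroAntitone⇒NoAscentAboveZero (0∷ anti)  (suc i) (suc j) (s≤s i<j) =
  NonzeroAntitone⇒NoAscentAboveZero anti i j i<j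
NonzeroAntitone⇒NoAscentAboveZero (_ ∷ anti) (suc i) (suc j) (s≤s i<j) =
  NonzeroAntitone⇒NoAscentAboveZero anti i j i<j

NoAscentAboveZero⇒NonzeroAntitone : (v : Vec ℕ n) → (∀ i → lookup v i ≤ m) →
  NoAscentAboveZero v → NonzeroAntitone m v
NoAscentAboveZero⇒NonzeroAntitone []          _  _     = []
NoAscentAboveZero⇒NonzeroAntitone (zero ∷ v)  ≤m noAsc = 0∷
  NoAscentAboveZero⇒NonzeroAntitone v (≤m ∘ suc) (λ i j → noAsc (suc i) (suc j) ∘ s≤s)
NoAscentAboveZero⇒NonzeroAntitone (suc x ∷ v) ≤m noAsc = ≤m zero ∷
  NoAscentAboveZero⇒NonzeroAntitone v (λ j → noAsc zero (suc j) (s≤s z≤n) (s≤s z≤n))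
    (λ i j → noAsc (suc i) (suc j) ∘ s≤s)

-- The entries in the roles of 1 and 2 form an ascent, and the lower one is positive because it
-- exceeds the entry in the role of 0. The same pair settles 012.
NoAscentAboveZero⇒Avoids102 : (e : Vec ℕ n) → NoAscentAboveZero e → Avoids e (1 ∷ 0 ∷ 2 ∷ [])
NoAscentAboveZero⇒Avoids102 e noAsc (i₁ , i₂ , i₃ , i₁<i₂ , i₂<i₃ , iso) =
  <⇒≱ (from (proj₁ (iso 0F 2F)) (s≤s (s≤s z≤n)))
      (noAsc i₁ i₃ (<-trans i₁<i₂ i₂<i₃)
        (≤-<-trans z≤n (from (proj₁ (iso 1F 0F)) (s≤s z≤n))))

NoAscentAboveZero⇒Avoids012 : (e : Vec ℕ n) → NoAscentAboveZero e → Avoids e (0 ∷ 1 ∷ 2 ∷ [])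
NoAscentAboveZero⇒Avoids012 e noAsc (i₁ , i₂ , i₃ , i₁<i₂ , i₂<i₃ , iso) =
  <⇒≱ (from (proj₁ (iso 1F 2F)) (s≤s (s≤s z≤n)))
      (noAsc i₂ i₃ i₂<i₃ (≤-<-trans z≤n (from (proj₁ (iso 0F 1F)) (s≤s z≤n))))

strictlyIncreasing⇒OrderIsomorphic : x < y → y < z →
  OrderIsomorphic (x ∷ y ∷ z ∷ []) (0 ∷ 1 ∷ 2 ∷ [])
strictlyIncreasing⇒OrderIsomorphic {x} {y} {z} x<y y<z = iso
  where
  refl-pair : (m < m ⇔ n < n) × (m ≡ m ⇔ n ≡ n)
  refl-pair = mk⇔ (⊥-elim ∘ <-irrefl refl) (⊥-elim ∘ <-irrefl refl) ,
              mk⇔ (λ _ → refl) (λ _ → refl)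

  increasing : m < n → p < q → (m < n ⇔ p < q) × (m ≡ n ⇔ p ≡ q)
  increasing m<n p<q = mk⇔ (λ _ → p<q) (λ _ → m<n) ,
    mk⇔ (λ eq → ⊥-elim (<⇒≢ m<n eq)) (λ eq → ⊥-elim (<⇒≢ p<q eq))

  decreasing : m < n → p < q → (n < m ⇔ q < p) × (n ≡ m ⇔ q ≡ p)
  decreasing m<n p<q = mk⇔ (⊥-elim ∘ <-asym m<n) (⊥-elim ∘ <-asym p<q) ,
    mk⇔ (λ eq → ⊥-elim (<⇒≢ m<n (sym eq))) (λ eq → ⊥-elim (<⇒≢ p<q (sym eq)))

  iso : OrderIsomorphic (x ∷ y ∷ z ∷ []) (0 ∷ 1 ∷ 2 ∷ [])
  iso 0F 0F = refl-pair
  iso 1F 1F = refl-pair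
  iso 2F 2F = refl-pair
  iso 0F 1F = increasing x<y (s≤s z≤n)
  iso 0F 2F = increasing (<-trans x<y y<z) (s≤s z≤n)
  iso 1F 2F = increasing y<z (s≤s (s≤s z≤n))
  iso 1F 0F = decreasing x<y (s≤s z≤n)
  iso 2F 0F = decreasing (<-trans x<y y<z) (s≤s z≤n)
  iso 2F 1F = decreasing y<z (s≤s (s≤s z≤n))

-- The first entry is 0, so it completes any later ascent above zero to a 012.
Avoids012⇒NoAscentAboveZero : (e : Vec ℕ n) → IsInversionSequence e →
  Avoids e (0 ∷ 1 ∷ 2 ∷ []) → NoAscentAboveZero e
Avoids012⇒NoAscentAboveZero (_ ∷ _) inv avoids zero    j       _   0<eᵢ =
  ⊥-elim (<⇒≱ 0<eᵢ (inv zero))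
Avoids012⇒NoAscentAboveZero (x ∷ e) inv avoids (suc i) (suc j) i<j 0<eᵢ = ≮⇒≥ λ eᵢ<eⱼ →
  avoids (zero , suc i , suc j , s≤s z≤n , i<j ,
    strictlyIncreasing⇒OrderIsomorphic (≤-<-trans (inv zero) 0<eᵢ) eᵢ<eⱼ)

-- In the notation 0^k m^q v of the header, m is i + 1 and q is q + 1 here.
Shape : ℕ → ℕ → ℕ → Vec ℕ n → Set
Shape k q i = Run 0 (Run (suc i) (AfterRun (suc i)) (suc q)) k

-- The second run has length `suc q`, so a positive entry `suc i` ends the zeros; its position gives
-- `k` and its value gives `i`.
Shape-injective : ∀ {k k′ p p′ i i′} {e : Vec ℕ n} →
  Shape k p i e → Shape k′ p′ i′ e → k ≡ k′ × i ≡ i′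
Shape-injective (stop (more _)) (stop (more _)) = refl , refl
Shape-injective (more shape)    (more shape′)
  with refl , i≡i′ ← Shape-injective shape shape′ = refl , i≡i′

card-Shape : ∀ k q i {r} → k + (suc q + r) ≡ n →
  HasCardinality (Shape {n} k q i) (afterRunCount i r)
card-Shape k q i refl = card-Run k (card-Run (suc q) (card-AfterRun i _))

run⇒NonzeroAntitone : {e : Vec ℕ n} →
  Run (suc i) (AfterRun (suc i)) q e → NonzeroAntitone (suc i) e
run⇒NonzeroAntitone (stop end)              = []
run⇒NonzeroAntitone (stop (descent _ anti)) = anti
run⇒NonzeroAntitone (more run)              = ≤-refl ∷ run⇒NonzeroAntitone run

NonzeroAntitone⇒run : {e : Vec ℕ n} → NonzeroAntitone (suc i) e →
  ∃[ q ] Run (suc i) (AfterRun (suc i)) q e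
NonzeroAntitone⇒run []        = 0 , stop end
NonzeroAntitone⇒run (0∷ anti) = 0 , stop (descent (s≤s z≤n) (0∷ anti))
NonzeroAntitone⇒run (j≤i ∷ anti) with m≤n⇒m<n∨m≡n j≤i
... | inj₁ j<i  = 0 , stop (descent j<i (j≤i ∷ anti))
... | inj₂ refl with q , run ← NonzeroAntitone⇒run anti = suc q , more run

Shape⇒NonzeroAntitone : {e : Vec ℕ n} → Shape k q i e → NonzeroAntitone (suc i) e
Shape⇒NonzeroAntitone (stop run)   = run⇒NonzeroAntitone run
Shape⇒NonzeroAntitone (more shape) = 0∷ Shape⇒NonzeroAntitone shape

-- First descent, maximum and inversion condition of a shape

fdes-∷-≤ : ∀ x y (e : Vec ℕ n) → x ≤ y → fdes (x ∷ y ∷ e) ≡ suc (fdes (y ∷ e))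
fdes-∷-≤ x y e x≤y with y <ᵇ x | <ᵇ-reflects-< y x
... | false | _       = refl
... | true  | ofʸ y<x = ⊥-elim (<⇒≱ y<x x≤y)

fdes-∷-> : ∀ x y (e : Vec ℕ n) → y < x → fdes (x ∷ y ∷ e) ≡ 1
fdes-∷-> x y e y<x with y <ᵇ x | <ᵇ-reflects-< y x
... | true  | _       = refl
... | false | ofⁿ y≮x = ⊥-elim (y≮x y<x)

run⇒fdes : {e : Vec ℕ n} → Run i (AfterRun i) (suc q) e → fdes e ≡ suc q
-- A run that reaches the end of the vector has its descent there by the convention on the entry
-- after the last.
run⇒fdes (more (stop end)) = refl
run⇒fdes {e = x ∷ y ∷ v} (more (stop (descent y<x _))) = fdes-∷-> x y v y<x
run⇒fdes {e = x ∷ _ ∷ v} (more (more run)) =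
  trans (fdes-∷-≤ x x v ≤-refl) (cong suc (run⇒fdes (more run)))

Shape⇒fdes : {e : Vec ℕ n} → Shape k q i e → fdes e ≡ k + suc q
Shape⇒fdes (stop run)               = run⇒fdes run
-- `y <ᵇ 0` computes to `false`, so a leading zero adds one to `fdes` by computation.
Shape⇒fdes (more (stop (more run))) = cong suc (run⇒fdes (more run))
Shape⇒fdes (more (more shape))      = cong suc (Shape⇒fdes (more shape))

Shape⇒max : {e : Vec ℕ n} → Shape k q i e → max e ≡ suc i
Shape⇒max (stop (more run)) = m≥n⇒m⊔n≡m (NonzeroAntitone⇒max≤ (run⇒NonzeroAntitone run))
Shape⇒max (more shape)      = Shape⇒max shape

-- The first positive entry `suc i` has index `k`, counted from 0, and the inversion condition is
-- read off there. The offset `c` counts zeros already removed.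
Shape⇒≤ : ∀ c {k q i} {e : Vec ℕ n} → (∀ j → lookup e j ≤ c + toℕ j) →
  Shape k q i e → suc i ≤ c + k
Shape⇒≤ c inv (stop (more _)) = inv zero
Shape⇒≤ c inv (more shape)    = ≤-trans
  (Shape⇒≤ (suc c) (λ j → ≤-trans (inv (suc j)) (≤-reflexive (+-suc c (toℕ j)))) shape)
  (≤-reflexive (sym (+-suc c _)))

-- The leading zeros satisfy every bound, and all later indices are at least `k`.
≤⇒IsInversionSequence : ∀ c {k} {Q : ∀ {n} → Vec ℕ n → Set} {e : Vec ℕ n} →
  (∀ j → lookup e j ≤ c + k) → Run 0 Q k e → ∀ j → lookup e j ≤ c + toℕ j
≤⇒IsInversionSequence c ≤c (stop _)   j       = ≤-trans (≤c j) (+-monoʳ-≤ c z≤n)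
≤⇒IsInversionSequence c ≤c (more run) zero    = z≤n
≤⇒IsInversionSequence c ≤c (more run) (suc j) = ≤-trans
  (≤⇒IsInversionSequence (suc c) (λ j → ≤-trans (≤c (suc j)) (≤-reflexive (+-suc c _))) run j)
  (≤-reflexive (sym (+-suc c (toℕ j))))

zeros⊎Shape : {e : Vec ℕ n} → NonzeroAntitone m e →
  (max e ≡ 0 × fdes e ≡ n) ⊎ (∃[ k ] ∃[ q ] ∃[ i ] Shape k q i e)
zeros⊎Shape [] = inj₁ (refl , refl)
zeros⊎Shape {e = _ ∷ []} (0∷ anti) = inj₁ (refl , refl)
zeros⊎Shape {e = _ ∷ _ ∷ _} (0∷ anti) with zeros⊎Shape anti
... | inj₁ (max≡0 , fdes≡n)    = inj₁ (max≡0 , cong suc fdes≡n)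
... | inj₂ (k , q , i , shape) = inj₂ (suc k , q , i , more shape)
zeros⊎Shape (_ ∷ anti) with q , run ← NonzeroAntitone⇒run anti =
  inj₂ (0 , q , _ , stop (more run))

-- Rank and the parameter `d`

open import Data.Integer using (+_)

-≡⇔≡+ : ∀ a b t → (+ a ℤ.- + b ℤ.- + 1 ≡ + t) ⇔ (a ≡ b + suc t)
-≡⇔≡+ a b t = mk⇔
  (λ eq → ℤ.+-injective (trans (regroup (+ a) (+ b)) (cong (λ z → + b ℤ.+ (+ 1 ℤ.+ z)) eq)))
  (λ { refl → cancel (+ b) (+ t) })
  where
  regroup : ∀ x y → x ≡ y ℤ.+ (+ 1 ℤ.+ (x ℤ.- y ℤ.- + 1))
  regroup = ℤ-Solver.solve-∀

  cancel : ∀ y z → y ℤ.+ (+ 1 ℤ.+ z) ℤ.- y ℤ.- + 1 ≡ z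
  cancel = ℤ-Solver.solve-∀

RankedAvoider : ℕ → Vec ℕ n → Set
RankedAvoider t e =
  IsInversionSequence e ×
  Avoids e (1 ∷ 0 ∷ 2 ∷ []) ×
  Avoids e (0 ∷ 1 ∷ 2 ∷ []) ×
  rank e ≡ + t

-- As `d` grows, the zeros gain what the run of `suc i` loses, so the first descent stays at
-- `suc i + suc t`. At least `suc i` zeros make it an inversion sequence.
Shape⇒RankedAvoider : ∀ d {i} {e : Vec ℕ n} → d ≤ t →
  Shape (suc i + d) (t ∸ d) i e → RankedAvoider t e
Shape⇒RankedAvoider {t = t} d {i} {e} d≤t shape =
  ≤⇒IsInversionSequence 0
    (λ j → ≤-trans (NonzeroAntitone⇒≤ anti j) (m≤m+n (suc i) d)) shape ,
  NoAscentAboveZero⇒Avoids102 e noAsc ,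
  NoAscentAboveZero⇒Avoids012 e noAsc ,
  from (-≡⇔≡+ (fdes e) (max e) t) (begin
    fdes e                    ≡⟨ Shape⇒fdes shape ⟩
    suc i + d + suc (t ∸ d)   ≡⟨ +-assoc (suc i) d _ ⟩
    suc i + (d + suc (t ∸ d)) ≡⟨ cong (λ m → suc i + m) (+-suc d (t ∸ d)) ⟩
    suc i + suc (d + (t ∸ d)) ≡⟨ cong (λ m → suc i + suc m) (m+[n∸m]≡n d≤t) ⟩
    suc i + suc t             ≡⟨ cong (λ m → m + suc t) (Shape⇒max shape) ⟨
    max e + suc t             ∎)
  where
  open ≡-Reasoning
  anti  = Shape⇒NonzeroAntitone shape
  noAsc = NonzeroAntitone⇒NoAscentAboveZero anti

-- The inversion condition gives `suc i ≤ k`, hence `d`. Comparing the two values of `fdes e` gives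
-- `d + q ≡ t`, and the bound on `i` holds because the zeros and the run fit into the vector.
Shape-parameters : ∀ {k q i} {e : Vec ℕ (t + 2 + m)} → IsInversionSequence e →
  fdes e ≡ max e + suc t → Shape k q i e →
  ∃[ d ] suc i + d ≡ k × d + q ≡ t × i < suc m
Shape-parameters {t} {m} {k} {q} {i} {e} inv fdes≡ shape
  with d , refl ← m≤n⇒∃[o]m+o≡n (Shape⇒≤ 0 inv shape) =
  d , refl , suc-injective (trans (sym (+-suc d q)) d+q+1≡t+1) ,
  +-cancelʳ-≤ (suc t) (suc i) (suc m) (begin
    suc i + suc t        ≡⟨ cong (λ b → suc i + b) d+q+1≡t+1 ⟨
    suc i + (d + suc q)  ≡⟨ +-assoc (suc i) d (suc q) ⟨
    suc i + d + suc q    ≤⟨ Run-length run-length shape ⟩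
    t + 2 + m            ≡⟨ shift t m ⟩
    suc m + suc t        ∎)
  where
  open ≤-Reasoning

  run-length : {v : Vec ℕ n} → Run (suc i) (AfterRun (suc i)) (suc q) v → suc q ≤ n
  run-length run = ≤-trans (m≤m+n (suc q) 0) (Run-length (λ _ → z≤n) run)

  d+q+1≡t+1 : d + suc q ≡ suc t
  d+q+1≡t+1 = +-cancelˡ-≡ (suc i) _ _
    (trans (sym (+-assoc (suc i) d (suc q)))
      (trans (sym (Shape⇒fdes shape))
        (trans fdes≡ (cong (λ b → b + suc t) (Shape⇒max shape)))))

  shift : ∀ t m → t + 2 + m ≡ suc m + suc t
  shift = solve-∀

RankedAvoider⇒Shape : (e : Vec ℕ (t + 2 + m)) → RankedAvoider t e →
  ∃[ d ] d < suc t × ∃[ i ] i < suc m × Shape (suc i + d) (t ∸ d) i e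
RankedAvoider⇒Shape {t} {m} e (inv , _ , avoids012 , rank≡t)
  with fdes≡ ← to (-≡⇔≡+ (fdes e) (max e) t) rank≡t
  -- Any upper bound on the entries will do to start with; the length is one.
  with zeros⊎Shape (NoAscentAboveZero⇒NonzeroAntitone e
         (λ j → ≤-trans (inv j) (<⇒≤ (toℕ<n j))) (Avoids012⇒NoAscentAboveZero e inv avoids012))
-- For the zero sequence `fdes e` is the length `t + 2 + m`, whereas rank `t` would require `suc t`.
... | inj₁ (max≡0 , fdes≡n) = ⊥-elim (m+1+n≢m (suc t)
  (trans (shift t m) (trans (sym fdes≡n) (trans fdes≡ (cong (λ b → b + suc t) max≡0)))))
  where
  shift : ∀ t m → suc t + suc m ≡ t + 2 + m
  shift = solve-∀
... | inj₂ (k , q , i , shape)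
  with d , refl , refl , i<m ← Shape-parameters {q = q} inv fdes≡ shape =
  d , s≤s (m≤m+n d q) , i , i<m ,
  subst (λ p → Shape (suc i + d) p i e) (sym (m+n∸m≡n d q)) shape

-- The outer union is over `d`, the inner one over `i + r′ ≡ m` with `r′` the length of the tail.
-- The inner count is the same for every `d`, hence the product.
card-RankedAvoider : ∀ t m →
  HasCardinality (RankedAvoider {t + 2 + m} t) (suc t * antidiagonalSum afterRunCount (suc m))
card-RankedAvoider t m = subst (HasCardinality _) (antidiagonalSum-const _ (suc t))
  (card-⇔ (λ e → mk⇔ (λ (d , d<t , _ , _ , shape) → Shape⇒RankedAvoider d (s≤s⁻¹ d<t) shape)
                     (RankedAvoider⇒Shape e))
    (card-⋃ (suc t) (λ _ _ → antidiagonalSum afterRunCount (suc m))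
      (λ (_ , _ , shape) (_ , _ , shape′) → equal-d (Shape-injective shape shape′))
      λ { d r refl → card-⋃ (suc m) afterRunCount
        (λ shape shape′ → proj₂ (Shape-injective shape shape′))
        λ { i r′ refl → card-Shape (suc i + d) (d + r ∸ d) i
          (trans (cong (λ q → suc i + d + (suc q + r′)) (m+n∸m≡n d r)) (total d r i r′)) } }))
  where
  equal-d : ∀ {d d′ i i′} → suc i + d ≡ suc i′ + d′ × i ≡ i′ → d ≡ d′
  equal-d {i = i} (eq , refl) = +-cancelˡ-≡ (suc i) _ _ eq

  total : ∀ d r i r′ → suc i + d + (suc r + r′) ≡ d + r + 2 + (i + r′)
  total = solve-∀

proposition5p5 : ∀ (n t : ℕ) → 2 ≤ n → t ≤ n ∸ 2 →
    HasCardinality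
    (λ (e : Vec ℕ n) →
    IsInversionSequence e ×
    Avoids e (1 ∷ 0 ∷ 2 ∷ []) ×
    Avoids e (0 ∷ 1 ∷ 2 ∷ []) ×
    rank e ≡ + t)
    ((t + 1) * F (2 * n ∸ 2 * t ∸ 3))
-- Here `m` is `n ∸ 2 ∸ t`; the Fibonacci index becomes `1 + m * 2`, so its truncated subtractions
-- are exact.
proposition5p5 n t 2≤n t≤n∸2 with m , refl ← m≤n⇒∃[o]m+o≡n (m≤o∸n⇒m+n≤o t 2≤n t≤n∸2) =
  subst (HasCardinality _)
    (cong₂ _*_ (+-comm 1 t) (trans (proj₁ (fibonacciSums m)) (cong F (sym index))))
    (card-RankedAvoider t m)
  where
  expand : ∀ t m → 2 * (t + 2 + m) ≡ 2 * t + (3 + (1 + m * 2))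
  expand = solve-∀

  index : 2 * (t + 2 + m) ∸ 2 * t ∸ 3 ≡ 1 + m * 2
  index = cong (_∸ 3) (trans (cong (_∸ 2 * t) (expand t m)) (m+n∸m≡n (2 * t) _))
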